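{- Let $n\ge 3$ and let $K$ be a proper $4$-coloring of $H_2(n,n-1)$. The following are equivalent: (i) there exist $v,w\in\mathcal{N}(0)=\{u\in\mathbb{Z}_2^n:\mathrm{wt}(u)\ge n-1\}$ such that $T(K)=\{(x,y): x+y\in\{v,w\}\}$; (ii) $\mathrm{rb}(K)=\frac{2}{n+1}$; (iii) the transition edges of $K$ tile the graph in $4$-cycles. Moreover, if one (hence each) of these holds, then the coloring of a single $4$-cycle of transition edges uniquely determines the coloring of the entire graph: if $K'$ is another proper $4$-coloring satisfying these conditions, $C$ is a $4$-cycle whose edges are transition edges for both $K$ and $K'$, and $K$ and $K'$ agree on the vertices of $C$, then $K=K'$.
   Context: $H_2(n,n-1)$ is the simple undirected graph with vertex set $\mathbb{Z}_2^n$ in which $x,y$ are adjacent iff their Hamming distance is at least $n-1$; $\mathrm{wt}$ is Hamming weight. For a simple graph $G=(V,E)$ and a proper $k$-coloring $K$, an edge $(x,y)\in E$ is a transition edge for $K$ if swapping the colors of $x$ and $y$ (all other colors unchanged) yields again a proper $k$-coloring; $T(K)$ is the set of transition edges and $\mathrm{rb}(K)=|T(K)|/|E|$ is the robustness. A set $M$ of edges tiles the graph in $4$-cycles if $M$ is the union of pairwise vertex-disjoint and edge-disjoint $4$-cycles and every vertex lies on exactly one of these cycles.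
   Formalization: In (i) the vectors v and w are required to be distinct; with v = w allowed the equivalence fails: for n = 3, copies of K₄ whose colors differ by a 4-cycle of colors give T(K) = {(x,y): x+y = v} and rb(K) = 1/4, not 1/2. -}

module Defs where

open import Data.Bool using (Bool; true; false; _xor_; if_then_else_)
import Data.Bool.Properties as Bool
open import Data.Fin using (Fin)
import Data.Fin.Properties as Fin
open import Data.Integer using (+_)
open import Data.List using (List; []; _∷_; _++_; map; length; filter; cartesianProductWith)
open import Data.List.Membership.Propositional using (_∈_)
open import Data.List.Membership.Propositional.Properties using (∈-cartesianProductWith⁺)
open import Data.List.Relation.Unary.All as All using (all?; []; _∷_)
open import Data.List.Relation.Unary.AllPairs using ([]; _∷_)
open import Data.List.Relation.Unary.Any using (here; there)
open import Data.List.Relation.Unary.Unique.Propositional using (Unique)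
open import Data.List.Relation.Unary.Unique.Propositional.Properties using (cartesianProductWith⁺)
open import Data.Nat using (ℕ; zero; suc; _≤_; _∸_; _≤?_)
open import Data.Product using (Σ-syntax; ∃!; _×_; _,_; uncurry)
open import Data.Rational using (ℚ; 0ℚ; _/_)
open import Data.Sum using (_⊎_)
open import Data.Vec using (Vec; []; _∷_; zipWith; count; lookup; allFin)
open import Data.Vec.Properties using (≡-dec; ∷-injective)
open import Function using (_⇔_; _∘_)
open import Relation.Binary.Definitions using (Decidable; DecidableEquality)
open import Relation.Binary.PropositionalEquality using (_≡_; _≢_; refl; sym; subst)
open import Relation.Nullary using (¬_; Dec; does; ¬?; _×-dec_; _→-dec_)
open import Relation.Nullary.Decidable using (map′)

record SimpleGraph : Set₁ where
  infix 4 _≟_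
  field
    V        : Set
    _≟_      : DecidableEquality V
    vertices : List V
    complete : ∀ v → v ∈ vertices
    unique   : Unique vertices
    Adj      : V → V → Set
    adj?     : Decidable Adj
    adj-sym  : ∀ {x y} → Adj x y → Adj y x
    irrefl   : ∀ {x} → ¬ Adj x x

-- Every unordered pair of distinct positions of a list, listed once.
pairs : {A : Set} → List A → List (A × A)
pairs []       = []
pairs (x ∷ xs) = map (x ,_) xs ++ pairs xs

-- Only used with b the number of edges of a graph; the value for an edgeless
-- graph is a convention.
ratio : ℕ → ℕ → ℚ
ratio a zero    = 0ℚ
ratio a (suc b) = + a / suc b

module _ (G : SimpleGraph) where
  open SimpleGraph G

  -- Sets of (undirected) edges are symmetric relations R ⊆ Adj; their
  -- cardinality counts unordered pairs.
  edgeCount : {R : V → V → Set} → Decidable R → ℕ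
  edgeCount R? = length (filter (uncurry R?) (pairs vertices))

  Coloring : ℕ → Set
  Coloring k = V → Fin k

  Proper : ∀ {k} → Coloring k → Set
  Proper K = ∀ x y → Adj x y → K x ≢ K y

  swap : ∀ {k} → Coloring k → V → V → Coloring k
  swap K x y z =
    if does (z ≟ x) then K y else if does (z ≟ y) then K x else K z

  Transition : ∀ {k} → Coloring k → V → V → Set
  Transition K x y = Adj x y × Proper (swap K x y)

  proper? : ∀ {k} (K : Coloring k) → Dec (Proper K)
  proper? K = map′
    (λ p x y → All.lookup (All.lookup p (complete x)) (complete y))
    (λ p → All.tabulate λ {x} _ → All.tabulate λ {y} _ → p x y)
    (all? (λ x → all? (λ y → adj? x y →-dec ¬? (K x Fin.≟ K y)) vertices) vertices)

  transition? : ∀ {k} (K : Coloring k) → Decidable (Transition K)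
  transition? K x y = adj? x y ×-dec proper? (swap K x y)

  rb : ∀ {k} → Coloring k → ℚ
  rb K = ratio (edgeCount (transition? K)) (edgeCount adj?)

  record FourCycle : Set where
    field
      a b c d  : V
      distinct : Unique (a ∷ b ∷ c ∷ d ∷ [])
      ab       : Adj a b
      bc       : Adj b c
      cd       : Adj c d
      da       : Adj d a

  VertexOf : FourCycle → V → Set
  VertexOf C v = v ∈ a ∷ b ∷ c ∷ d ∷ []
    where open FourCycle C

  EdgeOf : FourCycle → V → V → Set
  EdgeOf C x y = (x , y) ∈ sides ⊎ (y , x) ∈ sides
    where
    open FourCycle C
    sides : List (V × V)
    sides = (a , b) ∷ (b , c) ∷ (c , d) ∷ (d , a) ∷ []

  TilesInFourCycles : (V → V → Set) → Set
  TilesInFourCycles M =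
    Σ[ m ∈ ℕ ] Σ[ C ∈ (Fin m → FourCycle) ]
      (∀ x y → M x y ⇔ (Σ[ i ∈ Fin m ] EdgeOf (C i) x y))
    × (∀ i j → i ≢ j → ∀ v → ¬ (VertexOf (C i) v × VertexOf (C j) v))
    × (∀ i j → i ≢ j → ∀ x y → ¬ (EdgeOf (C i) x y × EdgeOf (C j) x y))
    × (∀ v → ∃! _≡_ λ i → VertexOf (C i) v)

-- ℤ₂ is Bool, with _xor_ as addition.
ℤ₂^ : ℕ → Set
ℤ₂^ n = Vec Bool n

infixl 6 _⊕_
_⊕_ : ∀ {n} → ℤ₂^ n → ℤ₂^ n → ℤ₂^ n
_⊕_ = zipWith _xor_

wt : ∀ {n} → ℤ₂^ n → ℕ
wt = count (Bool._≟ true)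

hamming : ∀ {n} → ℤ₂^ n → ℤ₂^ n → ℕ
hamming {n} x y = count (λ i → ¬? (lookup x i Bool.≟ lookup y i)) (allFin n)

bits : List Bool
bits = false ∷ true ∷ []

cube : ∀ n → List (ℤ₂^ n)
cube zero    = [] ∷ []
cube (suc n) = cartesianProductWith _∷_ bits (cube n)

cube-complete : ∀ {n} (x : ℤ₂^ n) → x ∈ cube n
cube-complete []      = here refl
cube-complete (b ∷ x) = ∈-cartesianProductWith⁺ _∷_ (bit b) (cube-complete x)
  where
  bit : ∀ b → b ∈ bits
  bit false = here refl
  bit true  = there (here refl)

cube-unique : ∀ n → Unique (cube n)
cube-unique zero    = [] ∷ []
cube-unique (suc n) =
  cartesianProductWith⁺ _∷_ ∷-injective
    (((λ ()) ∷ []) ∷ [] ∷ []) (cube-unique n)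

hamming-sym : ∀ {n} (x y : ℤ₂^ n) → hamming x y ≡ hamming y x
hamming-sym {n} x y = go (allFin n)
  where
  go : ∀ {m} (is : Vec (Fin n) m) →
       count (λ i → ¬? (lookup x i Bool.≟ lookup y i)) is
     ≡ count (λ i → ¬? (lookup y i Bool.≟ lookup x i)) is
  go []       = refl
  go (i ∷ is) with lookup x i | lookup y i | go is
  ... | false | false | eq = eq
  ... | true  | true  | eq = eq
  ... | false | true  | eq rewrite eq = refl
  ... | true  | false | eq rewrite eq = refl

-- The graph H₂(n,d). The condition x ≢ y follows from the distance condition
-- as soon as d ≥ 1.
H₂ : ℕ → ℕ → SimpleGraph
H₂ n d = record
  { V        = ℤ₂^ n
  ; _≟_      = ≡-dec Bool._≟_
  ; vertices = cube n
  ; complete = cube-complete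
  ; unique   = cube-unique n
  ; Adj      = λ x y → x ≢ y × d ≤ hamming x y
  ; adj?     = λ x y → ¬? (≡-dec Bool._≟_ x y) ×-dec (d ≤? hamming x y)
  ; adj-sym  = λ {x} {y} (x≢y , h) → x≢y ∘ sym , subst (d ≤_) (hamming-sym x y) h
  ; irrefl   = λ (x≢x , _) → x≢x refl
  }

module _ (n : ℕ) where

  G : SimpleGraph
  G = H₂ n (n ∸ 1)

  𝒩₀ : ℤ₂^ n → Set
  𝒩₀ u = n ∸ 1 ≤ wt u

  -- {v , w} is a genuine two-element set. Without v ≢ w the equivalence with
  -- the other conditions fails: for n = 3 the graph is K₄ □ K₂, and a proper
  -- 4-coloring whose two copies of K₄ differ by a cyclic permutation of the
  -- four colors has T(K) = {(x,y) : x + y = v} and robustness 1/4.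
  TwoClasses : Coloring G 4 → Set
  TwoClasses K =
    Σ[ v ∈ ℤ₂^ n ] Σ[ w ∈ ℤ₂^ n ]
      𝒩₀ v × 𝒩₀ w × v ≢ w
    × (∀ x y → Transition G K x y ⇔ (x ⊕ y ≡ v ⊎ x ⊕ y ≡ w))

  RobustnessCondition : Coloring G 4 → Set
  RobustnessCondition K = rb G K ≡ + 2 / suc n

  TransitionTiling : Coloring G 4 → Set
  TransitionTiling K = TilesInFourCycles G (Transition G K)

{-# OPTIONS --safe #-}

-- H₂(n , n ∸ 1) is the Cayley graph of ℤ₂ⁿ with the n + 1 connecting vectors of
-- 𝒩₀. If x y is a transition edge, y is the only neighbour of x of its colour;
-- as x has n + 1 ≥ 4 neighbours in three colours, at most two edges at x are
-- transition edges. By double counting, condition (ii) says that every vertex is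
-- on exactly two of them, and so does (iii). The remaining neighbours of x then
-- share the fourth colour; comparing this common colour at adjacent vertices shows
-- that the two transition directions g and h are the same at both, hence
-- everywhere, which is (i). Moreover x ⊕ g ⊕ h also has the fourth colour, so
-- the colours on one coset of {0 , g , h , g ⊕ h} determine those on all
-- neighbouring cosets.
module Submission where

open import Defs
open import Data.Bool using (true; false; not; _xor_)
import Data.Bool.Properties as Bool
open import Data.Fin as Fin using (Fin; zero; suc)
import Data.Fin.Properties as Fin
import Data.Integer as ℤ
import Data.Integer.Properties as ℤ
open import Data.List using (List; []; _∷_; _++_; map; length; filter; lookup; tabulate; deduplicate)
open import Data.List.Membership.Propositional using (_∈_; _∉_)
open import Data.List.Membership.Propositional.Properties using (∈-filter⁺; ∈-filter⁻; ∈-length; ∈-lookup; ∈-map⁺; ∈-map⁻; ∈-tabulate⁺; ∈-tabulate⁻)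
open import Data.List.Membership.Propositional.Properties.WithK using (unique∧set⇒bag)
open import Data.List.Properties using (filter-++; filter-reject; filter-≐; length-++; length-map; length-tabulate)
open import Data.List.Relation.Binary.BagAndSetEquality using (∼bag⇒↭)
open import Data.List.Relation.Binary.Permutation.Propositional.Properties using (↭-length)
open import Data.List.Relation.Unary.All as All using (All; []; _∷_)
open import Data.List.Relation.Unary.All.Properties using (all-filter)
open import Data.List.Relation.Unary.AllPairs as AllPairs using (AllPairs; []; _∷_)
import Data.List.Relation.Unary.AllPairs.Properties as AllPairs
open import Data.List.Relation.Unary.Any as Any using (here; there; any?)
open import Data.List.Relation.Unary.Any.Properties using (deduplicate⁺; lookup-index)
open import Data.List.Relation.Unary.Unique.Propositional using (Unique)
import Data.List.Relation.Unary.Unique.Propositional.Properties as Unique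
open import Data.Nat using (ℕ; zero; suc; _+_; _*_; _∸_; _≤_; _<_; z≤n; s≤s)
open import Data.Nat.ListAction using (sum)
open import Data.Nat.Properties hiding (_≟_)
open import Data.Nat.Solver using (module +-*-Solver)
open import Data.Product using (Σ-syntax; ∃-syntax; _×_; _,_; proj₁; proj₂; uncurry)
open import Data.Rational using (_/_)
import Data.Rational.Properties as ℚ
open import Data.Rational.Unnormalised using (mkℚᵘ; *≡*)
open import Data.Sum as Sum using (_⊎_; inj₁; inj₂; [_,_]′)
import Data.Vec as Vec
open import Data.Vec using ([]; _∷_; replicate; _[_]≔_; _[_]%=_)
open import Data.Vec.Properties using (≡-dec; ∷-injectiveʳ; zipWith-assoc; zipWith-comm; allFin-map; count≤n)
open import Function using (_⇔_; mk⇔; Equivalence; _∘_; id)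
open import Relation.Binary.Definitions using (Decidable; tri<; tri≈; tri>)
open import Relation.Binary.PropositionalEquality hiding ([_])
open import Relation.Nullary using (¬_; Dec; yes; no; does; ¬?; contradiction)
open import Relation.Nullary.Decidable using (dec-true; dec-false)

-- Lists: representatives, bounded sums and double counting.

module _ {A : Set} where

  AllPairs-lookup : {R : A → A → Set} {xs : List A} → AllPairs R xs →
                    ∀ i j → i Fin.< j → R (lookup xs i) (lookup xs j)
  AllPairs-lookup {xs = x ∷ xs} (px ∷ _)  zero    (suc j) _         = All.lookup px (∈-lookup j)
  AllPairs-lookup               (_ ∷ pxs) (suc i) (suc j) (s≤s i<j) = AllPairs-lookup pxs i j i<j

  -- Later used with membership in a coset as `R`, to pick one representative of each coset.
  deduplicate-separated : {R : A → A → Set} (R? : Decidable R) (xs : List A) →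
                          AllPairs (λ x y → ¬ R x y) (deduplicate R? xs)
  deduplicate-separated R? []       = []
  deduplicate-separated R? (x ∷ xs) =
    all-filter (¬? ∘ R? x) (deduplicate R? xs)
    ∷ AllPairs.filter⁺ (¬? ∘ R? x) (deduplicate-separated R? xs)

  Unique⇒length≡ : {xs ys : List A} → Unique xs → Unique ys →
                   (∀ {z} → z ∈ xs ⇔ z ∈ ys) → length xs ≡ length ys
  Unique⇒length≡ xs! ys! xs≈ys = ↭-length (∼bag⇒↭ (unique∧set⇒bag xs! ys! xs≈ys))

  length-filter-map : {B : Set} {P : B → Set} (P? : ∀ y → Dec (P y)) (f : A → B) (xs : List A) →
                      length (filter P? (map f xs)) ≡ length (filter (P? ∘ f) xs)
  length-filter-map P? f []       = refl
  length-filter-map P? f (x ∷ xs) with does (P? (f x)) | length-filter-map P? f xs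
  ... | true  | eq = cong suc eq
  ... | false | eq = eq

  module _ (f : A → ℕ) (c : ℕ) where

    sum-map-const : (∀ x → f x ≡ c) → ∀ xs → sum (map f xs) ≡ length xs * c
    sum-map-const f≡c []       = refl
    sum-map-const f≡c (x ∷ xs) = cong₂ _+_ (f≡c x) (sum-map-const f≡c xs)

    module _ (f≤c : ∀ x → f x ≤ c) where

      sum-map-≤ : ∀ xs → sum (map f xs) ≤ length xs * c
      sum-map-≤ []       = z≤n
      sum-map-≤ (x ∷ xs) = +-mono-≤ (f≤c x) (sum-map-≤ xs)

      -- One term below `c` would keep the whole sum strictly below `length xs * c`. This turns a
      -- global count of transition edges into a statement about each vertex.
      sum-map-max : ∀ xs → sum (map f xs) ≡ length xs * c → All (λ x → f x ≡ c) xs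
      sum-map-max []       _  = []
      sum-map-max (x ∷ xs) eq = fx≡c ∷ sum-map-max xs
        (+-cancelˡ-≡ c _ _ (trans (cong (_+ sum (map f xs)) (sym fx≡c)) eq))
        where
        fx≡c : f x ≡ c
        fx≡c = ≤-antisym (f≤c x) (≮⇒≥ λ fx<c → <⇒≢ (+-mono-<-≤ fx<c (sum-map-≤ xs)) eq)

  module _ {R : A → A → Set} (R? : Decidable R)
           (R-sym : ∀ {x y} → R x y → R y x) (R-irrefl : ∀ {x} → ¬ R x x) where

    private
      sum-degrees-∷ : ∀ x xs ys →
        sum (map (λ y → length (filter (R? y) (x ∷ xs))) ys)
        ≡ length (filter (λ y → R? y x) ys) + sum (map (λ y → length (filter (R? y) xs)) ys)
      sum-degrees-∷ x xs []       = refl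
      sum-degrees-∷ x xs (y ∷ ys) with does (R? y x) | sum-degrees-∷ x xs ys
      ... | true  | eq rewrite eq = cong suc
            (solve 3 (λ a b c → a :+ (b :+ c) := b :+ (a :+ c)) refl
               (length (filter (R? y) xs)) (length (filter (λ y → R? y x) ys))
               (sum (map (λ y → length (filter (R? y) xs)) ys)))
            where open +-*-Solver
      ... | false | eq rewrite eq =
            solve 3 (λ a b c → a :+ (b :+ c) := b :+ (a :+ c)) refl
               (length (filter (R? y) xs)) (length (filter (λ y → R? y x) ys))
               (sum (map (λ y → length (filter (R? y) xs)) ys))
            where open +-*-Solver

    -- Induction on the list: a new vertex `x` contributes its degree once through its own row and,
    -- by symmetry, once through its column in the other rows; irreflexivity removes the diagonal
    -- entry.
    handshake : ∀ xs → sum (map (λ x → length (filter (R? x) xs)) xs)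
                       ≡ 2 * length (filter (uncurry R?) (pairs xs))
    handshake []       = refl
    handshake (x ∷ xs) = begin
      length (filter (R? x) (x ∷ xs)) + sum (map (λ y → length (filter (R? y) (x ∷ xs))) xs)
        ≡⟨ cong₂ _+_ (cong length (filter-reject (R? x) R-irrefl)) (sum-degrees-∷ x xs xs) ⟩
      d + (length (filter (λ y → R? y x) xs) + sum (map (λ y → length (filter (R? y) xs)) xs))
        ≡⟨ cong (d +_) (cong₂ _+_ (cong length (filter-≐ (λ y → R? y x) (R? x) (R-sym , R-sym) xs))
                                  (handshake xs)) ⟩
      d + (d + 2 * e)
        ≡⟨ solve 2 (λ d e → d :+ (d :+ con 2 :* e) := con 2 :* (d :+ e)) refl d e ⟩
      2 * (d + e)
        ≡⟨ cong (λ m → 2 * (m + e)) (length-filter-map (uncurry R?) (x ,_) xs) ⟨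
      2 * (length (filter (uncurry R?) (map (x ,_) xs)) + e)
        ≡⟨ cong (2 *_) (length-++ (filter (uncurry R?) (map (x ,_) xs))) ⟨
      2 * length (filter (uncurry R?) (map (x ,_) xs) ++ filter (uncurry R?) (pairs xs))
        ≡⟨ cong (λ l → 2 * length l) (filter-++ (uncurry R?) (map (x ,_) xs) (pairs xs)) ⟨
      2 * length (filter (uncurry R?) (pairs (x ∷ xs))) ∎
      where
      open ≡-Reasoning
      open +-*-Solver
      d = length (filter (R? x) xs)
      e = length (filter (uncurry R?) (pairs xs))

-- Cross-multiplication; `0 < b` keeps clear of the conventional value of `ratio` for edgeless
-- graphs.
ratio≡2/ : ∀ a b n → 0 < b → ratio a b ≡ ℤ.+ 2 / suc n ⇔ a * suc n ≡ 2 * b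
ratio≡2/ a (suc b) n _ = mk⇔ to from
  where
  to : ratio a (suc b) ≡ ℤ.+ 2 / suc n → a * suc n ≡ 2 * suc b
  to eq with *≡* p ← ℚ./-injective-≃ (mkℚᵘ (ℤ.+ a) b) (mkℚᵘ (ℤ.+ 2) n) eq =
    ℤ.+-injective (trans (ℤ.pos-* a (suc n)) p)
  from : a * suc n ≡ 2 * suc b → ratio a (suc b) ≡ ℤ.+ 2 / suc n
  from eq = ℚ.fromℚᵘ-cong {mkℚᵘ (ℤ.+ a) b} {mkℚᵘ (ℤ.+ 2) n}
    (*≡* (trans (sym (ℤ.pos-* a (suc n))) (cong ℤ.+_ eq)))

-- If `d` and `e` differed, there would be five distinct elements of `Fin 4`.
fourth-colour : ∀ {a b c d e : Fin 4} → Unique (a ∷ b ∷ c ∷ []) →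
                All (_≢ d) (a ∷ b ∷ c ∷ []) → All (_≢ e) (a ∷ b ∷ c ∷ []) → d ≡ e
fourth-colour {a} {b} {c} {d} {e} ((a≢b ∷ a≢c ∷ []) ∷ (b≢c ∷ []) ∷ [] ∷ [])
              (a≢d ∷ b≢d ∷ c≢d ∷ []) (a≢e ∷ b≢e ∷ c≢e ∷ []) with d Fin.≟ e
... | yes d≡e = d≡e
... | no  d≢e with i , j , i<j , eq ← Fin.pigeonhole ≤-refl (lookup (a ∷ b ∷ c ∷ d ∷ e ∷ [])) =
  contradiction eq (AllPairs-lookup five i j i<j)
  where
  five : Unique (a ∷ b ∷ c ∷ d ∷ e ∷ [])
  five = (a≢b ∷ a≢c ∷ a≢d ∷ a≢e ∷ []) ∷ (b≢c ∷ b≢d ∷ b≢e ∷ []) ∷ (c≢d ∷ c≢e ∷ [])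
         ∷ (d≢e ∷ []) ∷ [] ∷ []

-- Transition edges in an arbitrary graph.

module _ (Γ : SimpleGraph) {k : ℕ} (K : Coloring Γ k) where
  open SimpleGraph Γ

  swap-left : ∀ x y → swap Γ K x y x ≡ K y
  swap-left x y rewrite dec-true (x ≟ x) refl = refl

  swap-other : ∀ x y {z} → z ≢ x → z ≢ y → swap Γ K x y z ≡ K z
  swap-other x y {z} z≢x z≢y rewrite dec-false (z ≟ x) z≢x | dec-false (z ≟ y) z≢y = refl

  swap-comm : ∀ x y z → swap Γ K x y z ≡ swap Γ K y x z
  swap-comm x y z with z ≟ x | z ≟ y
  ... | yes refl | yes refl = refl
  ... | yes _    | no  _    = refl
  ... | no  _    | yes _    = refl
  ... | no  _    | no  _    = refl

  transition-sym : ∀ {x y} → Transition Γ K x y → Transition Γ K y x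
  transition-sym {x} {y} (xy , proper) = adj-sym xy , λ p q pq eq →
    proper p q pq (trans (swap-comm x y p) (trans eq (swap-comm y x q)))

  -- After the swap `x` carries the colour `K y`, which a neighbour `z ≢ y` of that colour would
  -- still have as well.
  transition-unique : ∀ {x y z} → Transition Γ K x y → Adj x z → K z ≡ K y → z ≡ y
  transition-unique {x} {y} {z} (_ , proper) xz Kz≡Ky with z ≟ y
  ... | yes z≡y = z≡y
  ... | no  z≢y = contradiction
    (trans (swap-left x y) (trans (sym Kz≡Ky) (sym (swap-other x y z≢x z≢y))))
    (proper x z xz)
    where
    z≢x : z ≢ x
    z≢x refl = irrefl xz

-- Four-cycles in an arbitrary graph.

pattern at₀ = here refl
pattern at₁ = there (here refl)
pattern at₂ = there (there (here refl))
pattern at₃ = there (there (there (here refl)))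

cycle-neighbours : ∀ Γ (C : FourCycle Γ) {x} → VertexOf Γ C x →
                   ∃[ p ] ∃[ q ] p ≢ q × EdgeOf Γ C x p × EdgeOf Γ C x q
cycle-neighbours Γ C x∈ with FourCycle.distinct C | x∈
... | _ ∷ (_ ∷ b≢d ∷ []) ∷ _ | at₀ =
  _ , _ , b≢d , inj₁ at₀ , inj₂ at₃
... | (_ ∷ a≢c ∷ _ ∷ []) ∷ _ | at₁ =
  _ , _ , a≢c , inj₂ at₀ , inj₁ at₁
... | _ ∷ (_ ∷ b≢d ∷ []) ∷ _ | at₂ =
  _ , _ , b≢d , inj₂ at₁ , inj₁ at₂
... | (_ ∷ a≢c ∷ _ ∷ []) ∷ _ | at₃ =
  _ , _ , a≢c , inj₁ at₃ , inj₂ at₂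

edge-source : ∀ Γ (C : FourCycle Γ) {x y} → EdgeOf Γ C x y → VertexOf Γ C x
edge-source Γ C (inj₁ at₀) = at₀
edge-source Γ C (inj₁ at₁) = at₁
edge-source Γ C (inj₁ at₂) = at₂
edge-source Γ C (inj₁ at₃) = at₃
edge-source Γ C (inj₂ at₀) = at₁
edge-source Γ C (inj₂ at₁) = at₂
edge-source Γ C (inj₂ at₂) = at₃
edge-source Γ C (inj₂ at₃) = at₀

-- The group of binary vectors, weight and Hamming distance.

module _ {n : ℕ} where

  ⊕-assoc : (x y z : ℤ₂^ n) → x ⊕ y ⊕ z ≡ x ⊕ (y ⊕ z)
  ⊕-assoc = zipWith-assoc Bool.xor-assoc

  ⊕-comm : (x y : ℤ₂^ n) → x ⊕ y ≡ y ⊕ x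
  ⊕-comm = zipWith-comm Bool.xor-comm

  ⊕-swap : (x y z : ℤ₂^ n) → x ⊕ y ⊕ z ≡ x ⊕ z ⊕ y
  ⊕-swap x y z = trans (⊕-assoc x y z) (trans (cong (x ⊕_) (⊕-comm y z)) (sym (⊕-assoc x z y)))

⊕-self : ∀ {n} (x y : ℤ₂^ n) → x ⊕ (x ⊕ y) ≡ y
⊕-self []      []      = refl
⊕-self (a ∷ x) (b ∷ y) = cong₂ _∷_
  (trans (sym (Bool.xor-assoc a a b)) (cong (_xor b) (Bool.xor-same a))) (⊕-self x y)

module _ {n : ℕ} where

  ⊕-cancelˡ : (x : ℤ₂^ n) {y z : ℤ₂^ n} → x ⊕ y ≡ x ⊕ z → y ≡ z
  ⊕-cancelˡ x {y} {z} eq = trans (sym (⊕-self x y)) (trans (cong (x ⊕_) eq) (⊕-self x z))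

  ⊕-cancel : (x y : ℤ₂^ n) → x ⊕ y ⊕ y ≡ x
  ⊕-cancel x y = trans (⊕-comm (x ⊕ y) y) (trans (cong (y ⊕_) (⊕-comm x y)) (⊕-self y x))

wt-⊕-self : ∀ {n} (x : ℤ₂^ n) → wt (x ⊕ x) ≡ 0
wt-⊕-self []          = refl
wt-⊕-self (true  ∷ x) = wt-⊕-self x
wt-⊕-self (false ∷ x) = wt-⊕-self x

count-map : ∀ {A B : Set} {P : B → Set} (P? : ∀ y → Dec (P y)) (f : A → B) {n} (xs : Vec.Vec A n) →
            Vec.count P? (Vec.map f xs) ≡ Vec.count (P? ∘ f) xs
count-map P? f []       = refl
count-map P? f (x ∷ xs) with does (P? (f x)) | count-map P? f xs
... | true  | eq = cong suc eq
... | false | eq = eq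

hamming≡wt : ∀ {n} (x y : ℤ₂^ n) → hamming x y ≡ wt (x ⊕ y)
hamming≡wt []      []      = refl
hamming≡wt {suc n} (a ∷ x) (b ∷ y) = trans
  (cong (Vec.count (differ? a b)) (allFin-map n))
  (head a b (trans (count-map (differ? a b) suc (Vec.allFin n)) (hamming≡wt x y)))
  where
  differ? : ∀ a b i → Dec (Vec.lookup (a ∷ x) i ≢ Vec.lookup (b ∷ y) i)
  differ? a b i = ¬? (Vec.lookup (a ∷ x) i Bool.≟ Vec.lookup (b ∷ y) i)
  -- The bits are arguments here so that case analysis lets the test at position `zero` compute.
  head : ∀ a b → Vec.count (differ? a b) (Vec.map suc (Vec.allFin n)) ≡ wt (x ⊕ y) →
         Vec.count (differ? a b) (zero ∷ Vec.map suc (Vec.allFin n)) ≡ wt ((a ∷ x) ⊕ (b ∷ y))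
  head true  true  eq = eq
  head true  false eq = cong suc eq
  head false true  eq = cong suc eq
  head false false eq = eq

-- Connecting vectors and connectivity.

ones : ∀ n → ℤ₂^ n
ones n = replicate n true

-- Enumerates `𝒩₀` without repetition, so that degrees and pigeonhole arguments can be read off
-- `Fin (suc n)`.
gen : ∀ {n} → Fin (suc n) → ℤ₂^ n
gen         zero    = ones _
gen {suc n} (suc i) = ones (suc n) [ i ]≔ false

wt-ones : ∀ n → wt (ones n) ≡ n
wt-ones zero    = refl
wt-ones (suc n) = cong suc (wt-ones n)

gen-𝒩₀ : ∀ {n} (i : Fin (suc n)) → 𝒩₀ n (gen i)
gen-𝒩₀ {n}     zero    = ≤-trans (m∸n≤m n 1) (≤-reflexive (sym (wt-ones n)))
gen-𝒩₀ {suc n} (suc i) = ≤-reflexive (sym (go i))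
  where
  go : ∀ {n} (i : Fin (suc n)) → wt (ones (suc n) [ i ]≔ false) ≡ n
  go {n}     zero    = wt-ones n
  go {suc n} (suc i) = cong suc (go i)

full-weight : ∀ {n} (u : ℤ₂^ n) → n ≤ wt u → u ≡ ones n
full-weight []          _         = refl
full-weight (true  ∷ u) (s≤s n≤w) = cong (true ∷_) (full-weight u n≤w)
full-weight {suc n} (false ∷ u) n<w = contradiction (≤-trans n<w (count≤n _ u)) (n≮n n)

-- A leading zero uses up the only zero allowed, so the other entries are ones; a leading one leaves
-- the same problem for the tail.
𝒩₀⇒gen : ∀ {n} (u : ℤ₂^ n) → 𝒩₀ n u → ∃[ i ] u ≡ gen i
𝒩₀⇒gen []          _    = zero , refl
𝒩₀⇒gen (false ∷ u) n≤w  = suc zero , cong (false ∷_) (full-weight u n≤w)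
𝒩₀⇒gen {suc n} (true  ∷ u) n≤sw with 𝒩₀⇒gen u (∸-monoˡ-≤ 1 n≤sw)
... | zero  , refl = zero , refl
𝒩₀⇒gen {suc (suc n)} (true  ∷ u) n≤sw | suc i , refl = suc (suc i) , refl

gen-injective : ∀ {n} {i j : Fin (suc n)} → gen i ≡ gen j → i ≡ j
gen-injective               {i = zero}        {zero}        _  = refl
gen-injective {suc n}       {i = suc zero}    {suc zero}    _  = refl
gen-injective {suc (suc n)} {i = zero}        {suc (suc j)} eq
  with () ← gen-injective {i = zero} {suc j} (∷-injectiveʳ eq)
gen-injective {suc (suc n)} {i = suc (suc i)} {zero}        eq
  with () ← gen-injective {i = suc i} {zero} (∷-injectiveʳ eq)
gen-injective {suc (suc n)} {i = suc (suc i)} {suc (suc j)} eq =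
  cong suc (gen-injective {i = suc i} {suc j} (∷-injectiveʳ eq))

-- `gen zero` and `gen (suc i)` differ exactly in coordinate `i`, so their sum is a unit vector.
-- Hence the connecting vectors generate the group.
flip≡gens : ∀ {n} (x : ℤ₂^ n) i → x [ i ]%= not ≡ x ⊕ gen zero ⊕ gen (suc i)
flip≡gens {suc n} (a ∷ x) zero = cong₂ _∷_ (bit a) (sym (⊕-cancel x (ones n)))
  where
  bit : ∀ a → not a ≡ (a xor true) xor false
  bit true  = refl
  bit false = refl
flip≡gens {suc (suc n)} (a ∷ x) (suc i) = cong₂ _∷_ (bit a) (flip≡gens x i)
  where
  bit : ∀ a → a ≡ (a xor true) xor true
  bit true  = refl
  bit false = refl

-- Coordinates are corrected from left to right; the induction absorbs the settled ones into `P`.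
flip-connected : ∀ {n} (P : ℤ₂^ n → Set) → (∀ x i → P x → P (x [ i ]%= not)) → ∀ x y → P x → P y
flip-connected P step []      []      p = p
flip-connected P step (a ∷ x) (b ∷ y) p =
  flip-connected (λ z → P (b ∷ z)) (λ z i → step (b ∷ z) (suc i)) x y (head a b p)
  where
  head : ∀ a b → P (a ∷ x) → P (b ∷ x)
  head true  true  = id
  head true  false = step _ zero
  head false true  = step _ zero
  head false false = id

-- Each coordinate flip is a walk of two edges.
connected : ∀ {n} (P : ℤ₂^ n → Set) → (∀ x k → 𝒩₀ n k → P x → P (x ⊕ k)) → ∀ x y → P x → P y
connected {n} P step = flip-connected P λ x i p → subst P (sym (flip≡gens x i))
  (step _ _ (gen-𝒩₀ (suc i)) (step _ _ (gen-𝒩₀ {n} zero) p))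

-- There are `n + 1` connecting vectors and `ks` can hold at most `n` of them. With `3 ≤ n`, this
-- yields a direction outside any three given ones.
fresh : ∀ {n} (ks : List (ℤ₂^ n)) → length ks ≤ n → ∃[ k ] 𝒩₀ n k × k ∉ ks
fresh {n} ks len = gen (proj₁ missed) , gen-𝒩₀ (proj₁ missed) , proj₂ missed
  where
  not-all : ¬ (∀ i → gen i ∈ ks)
  not-all all with i , j , i<j , eq ← Fin.pigeonhole (s≤s len) (λ i → Any.index (all i)) =
    Fin.<⇒≢ i<j (gen-injective
      (trans (lookup-index (all i)) (trans (cong (lookup ks) eq) (sym (lookup-index (all j))))))
  missed : ∃[ i ] gen i ∉ ks
  missed = Fin.¬∀⟶∃¬ (suc n) (λ i → gen i ∈ ks) (λ i → any? (≡-dec Bool._≟_ (gen i)) ks) not-all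

-- Adjacency and degree in the Cayley graph.

adj⇒𝒩₀ : ∀ {n} (x y : ℤ₂^ n) → SimpleGraph.Adj (G n) x y → 𝒩₀ n (x ⊕ y)
adj⇒𝒩₀ {n} x y (_ , h) = subst (n ∸ 1 ≤_) (hamming≡wt x y) h

module _ {n : ℕ} (3≤n : 3 ≤ n) where
  open SimpleGraph (G n) using (Adj; adj?)

  private
    0<n∸1 : 0 < n ∸ 1
    0<n∸1 = ≤-trans (s≤s z≤n) (∸-monoˡ-≤ 1 3≤n)

  𝒩₀⇒adj : ∀ x {k} → 𝒩₀ n k → Adj x (x ⊕ k)
  𝒩₀⇒adj x {k} nk = x≢x⊕k , subst (n ∸ 1 ≤_)
    (trans (cong wt (sym (⊕-self x k))) (sym (hamming≡wt x (x ⊕ k)))) nk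
    where
    x≢x⊕k : x ≢ x ⊕ k
    -- If `x ≡ x ⊕ k`, then `k` is `x ⊕ x`, of weight 0, while `𝒩₀` demands weight at least `n ∸ 1`,
    -- which is positive.
    x≢x⊕k eq = n≮0 (≤-trans 0<n∸1 (≤-trans nk (≤-reflexive
      (trans (cong wt (trans (sym (⊕-self x k)) (cong (x ⊕_) (sym eq)))) (wt-⊕-self x)))))

  adj-degree : ∀ x → length (filter (adj? x) (cube n)) ≡ suc n
  adj-degree x = trans
    (Unique⇒length≡ (Unique.filter⁺ (adj? x) (cube-unique n))
      (Unique.map⁺ (⊕-cancelˡ x) (Unique.tabulate⁺ gen-injective)) (mk⇔ to from))
    (trans (length-map (x ⊕_) (tabulate gen)) (length-tabulate gen))
    where
    to : ∀ {z} → z ∈ filter (adj? x) (cube n) → z ∈ map (x ⊕_) (tabulate gen)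
    to {z} z∈ with i , eq ← 𝒩₀⇒gen (x ⊕ z) (adj⇒𝒩₀ x z (proj₂ (∈-filter⁻ (adj? x) {xs = cube n} z∈))) =
      subst (_∈ map (x ⊕_) (tabulate gen)) (trans (cong (x ⊕_) (sym eq)) (⊕-self x z))
        (∈-map⁺ (x ⊕_) (∈-tabulate⁺ {f = gen} i))
    from : ∀ {z} → z ∈ map (x ⊕_) (tabulate gen) → z ∈ filter (adj? x) (cube n)
    from z∈ with k , k∈ , refl ← ∈-map⁻ (x ⊕_) z∈ with i , refl ← ∈-tabulate⁻ {f = gen} k∈ =
      ∈-filter⁺ (adj? x) (cube-complete _) (𝒩₀⇒adj x (gen-𝒩₀ i))

  -- The tiling by cosets of a subgroup with two generators.

  module _ {v w : ℤ₂^ n} (nv : 𝒩₀ n v) (nw : 𝒩₀ n w) (v≢w : v ≢ w) where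

    -- A coset of the subgroup generated by `v` and `w`, in cyclic order so that it is
    -- definitionally the vertex list of `cosetCycle x`.
    coset : ℤ₂^ n → List (ℤ₂^ n)
    coset x = x ∷ x ⊕ v ∷ x ⊕ v ⊕ w ∷ x ⊕ w ∷ []

    private
      corner⊕v : ∀ x → x ⊕ v ⊕ w ⊕ v ≡ x ⊕ w
      corner⊕v x = trans (⊕-swap (x ⊕ v) w v) (cong (_⊕ w) (⊕-cancel x v))

    cosetCycle : ℤ₂^ n → FourCycle (G n)
    cosetCycle x = record
      { a = x ; b = x ⊕ v ; c = x ⊕ v ⊕ w ; d = x ⊕ w
      ; distinct = (x≢ nv ∷ x≢corner ∷ x≢ nw ∷ []) ∷ (x≢ nw ∷ v≢w ∘ ⊕-cancelˡ x ∷ [])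
                   ∷ ((λ eq → x≢ nv (trans (sym eq) (⊕-swap x v w))) ∷ []) ∷ [] ∷ []
      ; ab = 𝒩₀⇒adj x nv
      ; bc = 𝒩₀⇒adj (x ⊕ v) nw
      ; cd = subst (Adj (x ⊕ v ⊕ w)) (corner⊕v x) (𝒩₀⇒adj (x ⊕ v ⊕ w) nv)
      ; da = subst (Adj (x ⊕ w)) (⊕-cancel x w) (𝒩₀⇒adj (x ⊕ w) nw)
      }
      where
      x≢ : ∀ {x k} → 𝒩₀ n k → x ≢ x ⊕ k
      x≢ {x} nk = proj₁ (𝒩₀⇒adj x nk)
      x≢corner : x ≢ x ⊕ v ⊕ w
      x≢corner eq = v≢w (⊕-cancelˡ x (trans (sym (⊕-cancel (x ⊕ v) w)) (cong (_⊕ w) (sym eq))))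

    cosetEdge : ℤ₂^ n → ℤ₂^ n → ℤ₂^ n → Set
    cosetEdge r = EdgeOf (G n) (cosetCycle r)

    edge-v : ∀ r {x} → x ∈ coset r → cosetEdge r x (x ⊕ v)
    edge-v r at₀ = inj₁ at₀
    edge-v r at₁ = inj₂ (here (cong (_, r ⊕ v) (⊕-cancel r v)))
    edge-v r at₂ = inj₁ (there (there (here (cong (r ⊕ v ⊕ w ,_) (corner⊕v r)))))
    edge-v r at₃ = inj₂ (there (there (here (cong (_, r ⊕ w) (⊕-swap r w v)))))

    edge-w : ∀ r {x} → x ∈ coset r → cosetEdge r x (x ⊕ w)
    edge-w r at₀ = inj₂ at₃
    edge-w r at₁ = inj₁ at₁
    edge-w r at₂ = inj₂ (there (here (cong (_, r ⊕ v ⊕ w) (⊕-cancel (r ⊕ v) w))))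
    edge-w r at₃ = inj₁ (there (there (there (here (cong (r ⊕ w ,_) (⊕-cancel r w))))))

    edge-class : ∀ r {x y} → cosetEdge r x y → x ⊕ y ≡ v ⊎ x ⊕ y ≡ w
    edge-class r {x} {y} = [ side , Sum.map (trans (⊕-comm x y)) (trans (⊕-comm x y)) ∘ side ]′
      where
      side : ∀ {x y} → (x , y) ∈ (r , r ⊕ v) ∷ (r ⊕ v , r ⊕ v ⊕ w) ∷ (r ⊕ v ⊕ w , r ⊕ w) ∷ (r ⊕ w , r) ∷ [] →
             x ⊕ y ≡ v ⊎ x ⊕ y ≡ w
      side at₀ = inj₁ (⊕-self r v)
      side at₁ = inj₂ (⊕-self (r ⊕ v) w)
      side at₂ = inj₁ (trans (cong (r ⊕ v ⊕ w ⊕_) (sym (corner⊕v r))) (⊕-self (r ⊕ v ⊕ w) v))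
      side at₃ = inj₂ (trans (⊕-comm (r ⊕ w) r) (⊕-self r w))

    coset-trans : ∀ {x y z} → y ∈ coset x → z ∈ coset y → z ∈ coset x
    coset-trans {x} y∈ = λ
      { at₀ → y∈
      ; at₁ → ⊕v∈ y∈
      ; at₂ → ⊕w∈ (⊕v∈ y∈)
      ; at₃ → ⊕w∈ y∈ }
      where
      ⊕v∈ : ∀ {y} → y ∈ coset x → y ⊕ v ∈ coset x
      -- The far end of an edge is the source of the reversed edge.
      ⊕v∈ y∈ = edge-source (G n) (cosetCycle x) (Sum.swap (edge-v x y∈))
      ⊕w∈ : ∀ {y} → y ∈ coset x → y ⊕ w ∈ coset x
      ⊕w∈ y∈ = edge-source (G n) (cosetCycle x) (Sum.swap (edge-w x y∈))

    coset-sym : ∀ {x y} → y ∈ coset x → x ∈ coset y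
    coset-sym     at₀ = at₀
    coset-sym {x} at₁ = there (here (sym (⊕-cancel x v)))
    coset-sym {x} at₂ = there (there (here
      (trans (sym (⊕-cancel x w)) (cong (_⊕ w) (sym (corner⊕v x))))))
    coset-sym {x} at₃ = there (there (there (here (sym (⊕-cancel x w)))))

    coset-shift : ∀ {x z} k → z ∈ coset x → z ⊕ k ∈ coset (x ⊕ k)
    coset-shift     k at₀ = at₀
    coset-shift {x} k at₁ = there (here (⊕-swap x v k))
    coset-shift {x} k at₂ = there (there (here
      (trans (⊕-swap (x ⊕ v) w k) (cong (_⊕ w) (⊕-swap x v k)))))
    coset-shift {x} k at₃ = there (there (there (here (⊕-swap x w k))))

    -- The cosets partition the cube, and one cycle is taken per coset. Cycles with a common edge
    -- would share its source, so edge-disjointness follows from vertex-disjointness.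
    coset-tiling : {M : ℤ₂^ n → ℤ₂^ n → Set} → (∀ x y → M x y ⇔ (x ⊕ y ≡ v ⊎ x ⊕ y ≡ w)) →
                   TilesInFourCycles (G n) M
    coset-tiling {M} char =
      length reps , cycle , (λ x y → mk⇔ (M⇒edge x y) (edge⇒M x y)) , disjoint
      , (λ i j i≢j x y (e , e′) →
           disjoint i j i≢j x (edge-source (G n) (cycle i) e , edge-source (G n) (cycle j) e′))
      , λ x → proj₁ (cover x) , proj₂ (cover x) , same x
      where
      same-coset? : Decidable (λ x y → y ∈ coset x)
      same-coset? x y = any? (≡-dec Bool._≟_ y) (coset x)

      reps : List (ℤ₂^ n)
      reps = deduplicate same-coset? (cube n)

      cycle : Fin (length reps) → FourCycle (G n)
      cycle i = cosetCycle (lookup reps i)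

      separated : ∀ {i j} → i Fin.< j → ∀ x → ¬ (x ∈ coset (lookup reps i) × x ∈ coset (lookup reps j))
      separated {i} {j} i<j x (x∈i , x∈j) =
        AllPairs-lookup (deduplicate-separated same-coset? (cube n)) i j i<j
          (coset-trans x∈i (coset-sym x∈j))

      disjoint : ∀ i j → i ≢ j → ∀ x → ¬ (x ∈ coset (lookup reps i) × x ∈ coset (lookup reps j))
      disjoint i j i≢j x (x∈i , x∈j) with Fin.<-cmp i j
      ... | tri< i<j _ _ = separated i<j x (x∈i , x∈j)
      ... | tri≈ _ i≡j _ = i≢j i≡j
      ... | tri> _ _ j<i = separated j<i x (x∈j , x∈i)

      cover : ∀ x → ∃[ i ] x ∈ coset (lookup reps i)
      cover x = Any.index found , lookup-index found
        where
        found : Any.Any (λ r → x ∈ coset r) reps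
        -- A vertex dropped by `deduplicate` lies in the coset of one that is kept, so transitivity
        -- preserves the covering.
        found = deduplicate⁺ same-coset? coset-trans (Any.map here (cube-complete x))

      same : ∀ x {j} → x ∈ coset (lookup reps j) → proj₁ (cover x) ≡ j
      same x {j} x∈j with proj₁ (cover x) Fin.≟ j
      ... | yes eq = eq
      ... | no neq = contradiction (proj₂ (cover x) , x∈j) (disjoint _ j neq x)

      M⇒edge : ∀ x y → M x y → Σ[ i ∈ Fin (length reps) ] EdgeOf (G n) (cycle i) x y
      M⇒edge x y m = proj₁ (cover x) , [ along edge-v , along edge-w ]′ (Equivalence.to (char x y) m)
        where
        along : ∀ {g} → (∀ r {x} → x ∈ coset r → cosetEdge r x (x ⊕ g)) → x ⊕ y ≡ g →
                cosetEdge (lookup reps (proj₁ (cover x))) x y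
        along edge refl = subst (cosetEdge _ x) (⊕-self x y) (edge _ (proj₂ (cover x)))

      edge⇒M : ∀ x y → Σ[ i ∈ Fin (length reps) ] EdgeOf (G n) (cycle i) x y → M x y
      edge⇒M x y (i , e) = Equivalence.from (char x y) (edge-class (lookup reps i) e)

  -- Transition directions and edge counts.

  module _ (K : Coloring (G n) 4) where

    -- Transition edges are indexed by their direction `k`, so that directions can be compared at
    -- different vertices.
    T : ℤ₂^ n → ℤ₂^ n → Set
    T x k = Transition (G n) K x (x ⊕ k)

    T? : Decidable T
    T? x k = transition? (G n) K x (x ⊕ k)

    transition⇒T : ∀ {x y} → Transition (G n) K x y → T x (x ⊕ y)
    transition⇒T {x} {y} = subst (Transition (G n) K x) (sym (⊕-self x y))

    T⇒𝒩₀ : ∀ {x k} → T x k → 𝒩₀ n k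
    T⇒𝒩₀ {x} {k} t = subst (𝒩₀ n) (⊕-self x k) (adj⇒𝒩₀ x (x ⊕ k) (proj₁ t))

    T-sym : ∀ {x k} → T x k → T (x ⊕ k) k
    T-sym {x} {k} t =
      subst (Transition (G n) K (x ⊕ k)) (sym (⊕-cancel x k)) (transition-sym (G n) K t)

    T-unique : ∀ {x g k} → T x g → 𝒩₀ n k → K (x ⊕ k) ≡ K (x ⊕ g) → k ≡ g
    T-unique {x} t nk eq = ⊕-cancelˡ x (transition-unique (G n) K t (𝒩₀⇒adj x nk) eq)

    -- Uniqueness seen from the other end, `x ⊕ g`, of the transition edge.
    T-unique′ : ∀ {x g k} → T x g → 𝒩₀ n k → K (x ⊕ g ⊕ k) ≡ K x → k ≡ g
    T-unique′ {x} {g} t nk eq = T-unique (T-sym t) nk (trans eq (cong K (sym (⊕-cancel x g))))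

    -- The condition through which the equivalences pass. It asks for at least two directions,
    -- possibly varying with `x`; `T-at-most-two` supplies the upper bound for proper colorings.
    TwoRegular : Set
    TwoRegular = ∀ x → ∃[ g ] ∃[ h ] g ≢ h × T x g × T x h

    classes⇒T : ((v , w , _) : TwoClasses n K) → ∀ x → T x v × T x w
    classes⇒T (v , w , _ , _ , _ , char) x =
        Equivalence.from (char x (x ⊕ v)) (inj₁ (⊕-self x v))
      , Equivalence.from (char x (x ⊕ w)) (inj₂ (⊕-self x w))

    classes⇒regular : TwoClasses n K → TwoRegular
    classes⇒regular tc@(v , w , _ , _ , v≢w , _) x = v , w , v≢w , classes⇒T tc x

    tiling⇒regular : TransitionTiling n K → TwoRegular
    tiling⇒regular (m , C , char , _ , _ , cover) x
      with i , x∈Cᵢ , _ ← cover x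
      with p , q , p≢q , xp , xq ← cycle-neighbours (G n) (C i) x∈Cᵢ =
      x ⊕ p , x ⊕ q , p≢q ∘ ⊕-cancelˡ x
      , transition⇒T (Equivalence.from (char x p) (i , xp))
      , transition⇒T (Equivalence.from (char x q) (i , xq))

    transition-degree : ℤ₂^ n → ℕ
    transition-degree x = length (filter (transition? (G n) K x) (cube n))

    degree≡2⇒regular : (∀ x → transition-degree x ≡ 2) → TwoRegular
    degree≡2⇒regular deg x = two (filter (transition? (G n) K x) (cube n))
      (Unique.filter⁺ (transition? (G n) K x) (cube-unique n))
      (all-filter (transition? (G n) K x) (cube n)) (deg x)
      where
      two : ∀ ys → Unique ys → All (Transition (G n) K x) ys → length ys ≡ 2 →
            ∃[ g ] ∃[ h ] g ≢ h × T x g × T x h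
      two (p ∷ q ∷ []) ((p≢q ∷ []) ∷ _) (tp ∷ tq ∷ []) _ =
        x ⊕ p , x ⊕ q , p≢q ∘ ⊕-cancelˡ x , transition⇒T tp , transition⇒T tq

    private
      order = length (cube n)
      τ     = edgeCount (G n) (transition? (G n) K)
      ε     = edgeCount (G n) adj?

    sum-transition-degrees : sum (map transition-degree (cube n)) ≡ 2 * τ
    sum-transition-degrees = handshake (transition? (G n) K) (transition-sym (G n) K)
      (SimpleGraph.irrefl (G n) ∘ proj₁) (cube n)

    order-edges : order * suc n ≡ 2 * ε
    order-edges = trans (sym (sum-map-const _ (suc n) adj-degree (cube n)))
      (handshake adj? (λ {x} {y} → SimpleGraph.adj-sym (G n) {x} {y}) (SimpleGraph.irrefl (G n)) (cube n))

    ε>0 : 0 < ε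
    -- Without edges, `order-edges` would force the vertex list to be empty.
    ε>0 = n≢0⇒n>0 λ ε≡0 → <⇒≢ (∈-length (cube-complete (ones n)))
      (sym (m*n≡0⇒m≡0 order (suc n) (trans order-edges (cong (2 *_) ε≡0))))

    -- As `order * suc n ≡ 2 * ε`, the robustness is `2 / suc n` exactly when the average transition
    -- degree is two.
    rb⇔order : RobustnessCondition n K ⇔ τ ≡ order
    rb⇔order = mk⇔
      (λ eq → *-cancelʳ-≡ τ order (suc n) (trans (Equivalence.to ratio⇔ eq) (sym order-edges)))
      (λ eq → Equivalence.from ratio⇔ (trans (cong (_* suc n) eq) order-edges))
      where
      ratio⇔ = ratio≡2/ τ ε n ε>0

    classes⇒tiling : TwoClasses n K → TransitionTiling n K
    classes⇒tiling (_ , _ , nv , nw , v≢w , char) = coset-tiling nv nw v≢w char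

    -- Colours around a vertex of a proper coloring.

    module _ (proper : Proper (G n) K) where

      K≢ : ∀ x {k} → 𝒩₀ n k → K x ≢ K (x ⊕ k)
      K≢ x nk = proper x _ (𝒩₀⇒adj x nk)

      -- `x ⊕ h` is the only neighbour of `x` in its colour, so `x ⊕ g` has another one.
      T-colours : ∀ {x g h} → T x g → T x h → g ≢ h → Unique (K x ∷ K (x ⊕ g) ∷ K (x ⊕ h) ∷ [])
      T-colours {x} tg th g≢h =
        (K≢ x (T⇒𝒩₀ tg) ∷ K≢ x (T⇒𝒩₀ th) ∷ []) ∷ (g≢h ∘ T-unique th (T⇒𝒩₀ tg) ∷ []) ∷ [] ∷ []

      T-avoids : ∀ {x g h k} → T x g → T x h → 𝒩₀ n k → k ≢ g → k ≢ h →
                 All (_≢ K (x ⊕ k)) (K x ∷ K (x ⊕ g) ∷ K (x ⊕ h) ∷ [])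
      T-avoids {x} tg th nk k≢g k≢h =
        K≢ x nk ∷ k≢g ∘ T-unique tg nk ∘ sym ∷ k≢h ∘ T-unique th nk ∘ sym ∷ []

      -- The colour `K x` is excluded because `x` is the only neighbour of `x ⊕ g` carrying it; the
      -- other two vertices are adjacent to the corner.
      T-avoids-corner : ∀ {x g h} → T x g → T x h → g ≢ h →
                        All (_≢ K (x ⊕ g ⊕ h)) (K x ∷ K (x ⊕ g) ∷ K (x ⊕ h) ∷ [])
      T-avoids-corner {x} {g} {h} tg th g≢h =
        (g≢h ∘ sym ∘ T-unique′ tg (T⇒𝒩₀ th) ∘ sym)
        ∷ K≢ (x ⊕ g) (T⇒𝒩₀ th)
        ∷ (λ eq → K≢ (x ⊕ h) (T⇒𝒩₀ tg) (trans eq (cong K (⊕-swap x g h)))) ∷ []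

      -- A third direction `l` and a fresh direction `k` would both lead to the fourth colour,
      -- although `x ⊕ l` must be the only neighbour of `x` in its colour.
      T-at-most-two : ∀ {x g h l} → T x g → T x h → g ≢ h → T x l → l ≡ g ⊎ l ≡ h
      T-at-most-two {x} {g} {h} {l} tg th g≢h tl with ≡-dec Bool._≟_ l g | ≡-dec Bool._≟_ l h
      ... | yes l≡g | _       = inj₁ l≡g
      ... | no  _   | yes l≡h = inj₂ l≡h
      ... | no  l≢g | no  l≢h with k , nk , k∉ ← fresh (g ∷ h ∷ l ∷ []) 3≤n =
        contradiction (T-unique tl nk same) (k∉ ∘ there ∘ there ∘ here)
        where
        same : K (x ⊕ k) ≡ K (x ⊕ l)
        same = fourth-colour (T-colours tg th g≢h)
          (T-avoids tg th nk (k∉ ∘ here) (k∉ ∘ there ∘ here))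
          (T-avoids tg th (T⇒𝒩₀ tl) l≢g l≢h)

      -- From local to global transition directions.

      module _ (regular : TwoRegular) where

        ¬T-colour : ∀ {x k l} → 𝒩₀ n k → 𝒩₀ n l → ¬ T x k → ¬ T x l → K (x ⊕ k) ≡ K (x ⊕ l)
        ¬T-colour {x} nk nl ¬tk ¬tl with g , h , g≢h , tg , th ← regular x =
          fourth-colour (T-colours tg th g≢h)
            (T-avoids tg th nk (λ { refl → ¬tk tg }) (λ { refl → ¬tk th }))
            (T-avoids tg th nl (λ { refl → ¬tl tg }) (λ { refl → ¬tl th }))

        -- Otherwise x ⊕ k ⊕ g and x, both reached from x ⊕ k by non-transition
        -- edges, share a colour, and x ⊕ g has two neighbours of colour K x.
        T-across-other : ∀ {x g k} → 𝒩₀ n k → T x g → ¬ T x k → T (x ⊕ k) g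
        T-across-other {x} {g} {k} nk tg ¬tk with T? (x ⊕ k) g
        ... | yes t = t
        ... | no ¬t = contradiction (subst (T x) g≡k tg) ¬tk
          where
          same : K (x ⊕ g ⊕ k) ≡ K x
          same = trans (cong K (⊕-swap x g k))
            (trans (¬T-colour (T⇒𝒩₀ tg) nk ¬t
                     (λ t → ¬tk (subst (λ z → T z k) (⊕-cancel x k) (T-sym t))))
                   (cong K (⊕-cancel x k)))
          g≡k : g ≡ k
          g≡k = sym (T-unique′ tg nk same)

        -- Every k outside {g , h} gives K (x ⊕ g ⊕ k) ≡ K (x ⊕ h). There are two
        -- such k, so this is the colour of all non-transition neighbours of x ⊕ g;
        -- x ⊕ g ⊕ h is not one of them, being adjacent to x ⊕ h.
        T-across-transition : ∀ {x g h} → T x g → T x h → g ≢ h → T (x ⊕ g) h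
        T-across-transition {x} {g} {h} tg th g≢h with T? (x ⊕ g) h
        ... | yes t = t
        ... | no ¬t
          with k , nk , k∉ ← fresh (g ∷ h ∷ []) (≤-trans (n≤1+n 2) 3≤n)
          with l , nl , l∉ ← fresh (k ∷ g ∷ h ∷ []) 3≤n =
          contradiction
            (trans (sym (colour nk k∉)) (trans (¬T-colour nk (T⇒𝒩₀ th) ¬tk ¬t) (cong K (⊕-swap x g h))))
            (K≢ (x ⊕ h) (T⇒𝒩₀ tg))
          where
          -- Both sides avoid the distinct colours of `x`, `x ⊕ g` and `x ⊕ k`: `x ⊕ g ⊕ k` is
          -- adjacent to the last two and, as `k ≢ g`, cannot have colour `K x`.
          colour : ∀ {k} → 𝒩₀ n k → k ∉ g ∷ h ∷ [] → K (x ⊕ g ⊕ k) ≡ K (x ⊕ h)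
          colour {k} nk k∉ = fourth-colour
            {a = K x} {b = K (x ⊕ g)} {c = K (x ⊕ k)}
            ((K≢ x (T⇒𝒩₀ tg) ∷ K≢ x nk ∷ []) ∷ ((k∉ ∘ here ∘ T-unique tg nk ∘ sym) ∷ []) ∷ [] ∷ [])
            ((k∉ ∘ here ∘ T-unique′ tg nk ∘ sym)
              ∷ K≢ (x ⊕ g) nk
              ∷ (λ eq → K≢ (x ⊕ k) (T⇒𝒩₀ tg) (trans eq (cong K (⊕-swap x g k)))) ∷ [])
            (K≢ x (T⇒𝒩₀ th)
              ∷ (g≢h ∘ T-unique th (T⇒𝒩₀ tg))
              ∷ (k∉ ∘ there ∘ here ∘ T-unique th nk) ∷ [])
          ¬tk : ¬ T (x ⊕ g) k
          ¬tk tk = l∉ (here (T-unique tk nl (trans (colour nl (l∉ ∘ there)) (sym (colour nk k∉)))))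

        -- Connectivity reduces this to a single edge: the one along `g` itself, another transition
        -- edge, or a non-transition edge.
        T-invariant : ∀ {x g} y → T x g → T y g
        T-invariant {x} {g} y = connected (λ z → T z g) step x y
          where
          step : ∀ x k → 𝒩₀ n k → T x g → T (x ⊕ k) g
          step x k nk tg with ≡-dec Bool._≟_ k g | T? x k
          ... | yes refl | _       = T-sym tg
          ... | no  k≢g  | yes tk  = T-across-transition tk tg k≢g
          ... | no  _    | no  ¬tk = T-across-other nk tg ¬tk

        regular⇒classes : TwoClasses n K
        -- `ones n` is an arbitrary base vertex: invariance carries every transition direction to
        -- it, and back from it to any vertex.
        regular⇒classes with v , w , v≢w , tv , tw ← regular (ones n) =
          v , w , T⇒𝒩₀ tv , T⇒𝒩₀ tw , v≢w , λ x y → mk⇔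
            (λ t → T-at-most-two tv tw v≢w (T-invariant (ones n) (transition⇒T t)))
            [ (λ eq → along eq tv) , (λ eq → along eq tw) ]′
          where
          along : ∀ {x y g} → x ⊕ y ≡ g → T (ones n) g → Transition (G n) K x y
          along {x} {y} refl t = subst (Transition (G n) K x) (⊕-self x y) (T-invariant x t)

      -- Transition degrees and robustness.

      transition-degree≤2 : ∀ x → transition-degree x ≤ 2
      transition-degree≤2 x = bound (filter (transition? (G n) K x) (cube n))
        (Unique.filter⁺ (transition? (G n) K x) (cube-unique n))
        (all-filter (transition? (G n) K x) (cube n))
        where
        bound : ∀ ys → Unique ys → All (Transition (G n) K x) ys → length ys ≤ 2
        bound []           _ _ = z≤n
        bound (_ ∷ [])     _ _ = s≤s z≤n
        bound (_ ∷ _ ∷ []) _ _ = ≤-refl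
        bound (p ∷ q ∷ r ∷ _) ((p≢q ∷ p≢r ∷ _) ∷ (q≢r ∷ _) ∷ _) (tp ∷ tq ∷ tr ∷ _) =
          contradiction
            (T-at-most-two (transition⇒T tp) (transition⇒T tq) (p≢q ∘ ⊕-cancelˡ x) (transition⇒T tr))
            [ p≢r ∘ sym ∘ ⊕-cancelˡ x , q≢r ∘ sym ∘ ⊕-cancelˡ x ]′

      regular⇒degree≡2 : TwoRegular → ∀ x → transition-degree x ≡ 2
      regular⇒degree≡2 regular x with g , h , g≢h , tg , th ← regular x =
        ≤-antisym (transition-degree≤2 x) (two _ (member tg) (member th) (g≢h ∘ ⊕-cancelˡ x))
        where
        member : ∀ {y} → Transition (G n) K x y → y ∈ filter (transition? (G n) K x) (cube n)
        member = ∈-filter⁺ (transition? (G n) K x) (cube-complete _)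
        two : ∀ {p q} (ys : List (ℤ₂^ n)) → p ∈ ys → q ∈ ys → p ≢ q → 2 ≤ length ys
        two (_ ∷ [])    at₀ at₀ p≢q = contradiction refl p≢q
        two (_ ∷ _ ∷ _) _   _   _   = s≤s (s≤s z≤n)

      -- The degree sum `2 * τ` equals `order * 2`, the largest value that degrees of at most two
      -- allow, so no vertex falls short.
      rb⇒regular : RobustnessCondition n K → TwoRegular
      rb⇒regular eq = degree≡2⇒regular λ x → All.lookup
        (sum-map-max transition-degree 2 transition-degree≤2 (cube n)
          (trans sum-transition-degrees
            (trans (*-comm 2 τ) (cong (_* 2) (Equivalence.to rb⇔order eq)))))
        (cube-complete x)

      regular⇒rb : TwoRegular → RobustnessCondition n K
      regular⇒rb regular = Equivalence.from rb⇔order (*-cancelʳ-≡ τ order 2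
        (trans (*-comm τ 2) (trans (sym sum-transition-degrees)
          (sum-map-const transition-degree 2 (regular⇒degree≡2 regular) (cube n)))))

      satisfies⇒regular : TwoClasses n K ⊎ RobustnessCondition n K ⊎ TransitionTiling n K → TwoRegular
      satisfies⇒regular (inj₁ classes)       = classes⇒regular classes
      satisfies⇒regular (inj₂ (inj₁ robust)) = rb⇒regular robust
      satisfies⇒regular (inj₂ (inj₂ tiling)) = tiling⇒regular tiling

  -- Rigidity: one square determines the coloring.

  module _ {K K' : Coloring (G n) 4} (proper : Proper (G n) K) (proper' : Proper (G n) K')
           {g h : ℤ₂^ n} (g≢h : g ≢ h)
           (tg : ∀ x → T K x g) (th : ∀ x → T K x h)
           (tg' : ∀ x → T K' x g) (th' : ∀ x → T K' x h) where

    private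
      ng : 𝒩₀ n g
      ng = T⇒𝒩₀ K (tg (ones n))
      nh : 𝒩₀ n h
      nh = T⇒𝒩₀ K (th (ones n))

    -- A neighbour x ⊕ k outside the 4-cycle of x takes the fourth colour, which
    -- is that of the opposite corner x ⊕ g ⊕ h.
    agree-from-square : ∀ x → K x ≡ K' x → K (x ⊕ g) ≡ K' (x ⊕ g) → K (x ⊕ h) ≡ K' (x ⊕ h) →
                        ∀ y → K y ≡ K' y
    agree-from-square x e eg eh y = All.head (connected Agree step x y (e ∷ eg ∷ corner ∷ eh ∷ []))
      where
      -- Agreement is carried for whole cosets, since the next step reads colours at opposite
      -- corners.
      Agree : ℤ₂^ n → Set
      Agree z = All (λ u → K u ≡ K' u) (coset ng nh g≢h z)

      -- Under either coloring the corner has the colour missing from the other three vertices,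
      -- where the colorings agree.
      corner : K (x ⊕ g ⊕ h) ≡ K' (x ⊕ g ⊕ h)
      corner = fourth-colour (T-colours K proper (tg x) (th x) g≢h)
        (T-avoids-corner K proper (tg x) (th x) g≢h) avoids
        where
        avoids : All (_≢ K' (x ⊕ g ⊕ h)) (K x ∷ K (x ⊕ g) ∷ K (x ⊕ h) ∷ [])
        avoids rewrite e | eg | eh = T-avoids-corner K' proper' (tg' x) (th' x) g≢h

      step : ∀ z k → 𝒩₀ n k → Agree z → Agree (z ⊕ k)
      step z k nk agree with ≡-dec Bool._≟_ k g | ≡-dec Bool._≟_ k h
      ... | yes refl | _        = All.tabulate λ u∈ → All.lookup agree (coset-trans ng nh g≢h at₁ u∈)
      ... | no  _    | yes refl = All.tabulate λ u∈ → All.lookup agree (coset-trans ng nh g≢h at₃ u∈)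
      -- `u ⊕ k` lies in the coset of `z`, hence so does its opposite corner; and `u` is the
      -- neighbour of `u ⊕ k` in direction `k`.
      ... | no  k≢g  | no  k≢h  = All.tabulate λ {u} u∈ → begin
        K u               ≡⟨ cong K (⊕-cancel u k) ⟨
        K (u ⊕ k ⊕ k)     ≡⟨ fourth-colour (T-colours K proper (tg _) (th _) g≢h)
                               (T-avoids K proper (tg _) (th _) nk k≢g k≢h)
                               (T-avoids-corner K proper (tg _) (th _) g≢h) ⟩
        K (u ⊕ k ⊕ g ⊕ h) ≡⟨ All.lookup agree (coset-trans ng nh g≢h (shifted u∈) at₂) ⟩
        K' (u ⊕ k ⊕ g ⊕ h) ≡⟨ fourth-colour (T-colours K' proper' (tg' _) (th' _) g≢h)
                               (T-avoids K' proper' (tg' _) (th' _) nk k≢g k≢h)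
                               (T-avoids-corner K' proper' (tg' _) (th' _) g≢h) ⟨
        K' (u ⊕ k ⊕ k)    ≡⟨ cong K' (⊕-cancel u k) ⟩
        K' u              ∎
        where
        open ≡-Reasoning
        shifted : ∀ {u} → u ∈ coset ng nh g≢h (z ⊕ k) → u ⊕ k ∈ coset ng nh g≢h z
        shifted {u} u∈ = subst (λ r → u ⊕ k ∈ coset ng nh g≢h r) (⊕-cancel z k) (coset-shift ng nh g≢h k u∈)

theorem5p2 : (n : ℕ) → 3 ≤ n → (K : Coloring (G n) 4) → Proper (G n) K →
    (TwoClasses n K ⇔ RobustnessCondition n K)
    × (RobustnessCondition n K ⇔ TransitionTiling n K)
    × ((TwoClasses n K ⊎ RobustnessCondition n K ⊎ TransitionTiling n K) →
    (K' : Coloring (G n) 4) → Proper (G n) K' →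
    (TwoClasses n K' ⊎ RobustnessCondition n K' ⊎ TransitionTiling n K') →
    (C : FourCycle (G n)) →
    (∀ x y → EdgeOf (G n) C x y → Transition (G n) K x y × Transition (G n) K' x y) →
    (∀ x → VertexOf (G n) C x → K x ≡ K' x) →
    ∀ x → K x ≡ K' x)
theorem5p2 n 3≤n K proper =
    mk⇔ (regular⇒rb 3≤n K proper ∘ classes⇒regular 3≤n K)
        (regular⇒classes 3≤n K proper ∘ rb⇒regular 3≤n K proper)
  , mk⇔ (classes⇒tiling 3≤n K ∘ regular⇒classes 3≤n K proper ∘ rb⇒regular 3≤n K proper)
        (regular⇒rb 3≤n K proper ∘ tiling⇒regular 3≤n K)
  , λ cond K' proper' cond' C edges agree →
      let open FourCycle C
          -- The two sides of `C` at `a` supply the common directions `a ⊕ b` and `a ⊕ d`, which are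
          -- distinct because `b` and `d` are.
          b≢d : b ≢ d
          b≢d = All.lookup (AllPairs.head (AllPairs.tail distinct)) at₁
          ab-T = edges a b (inj₁ at₀)
          ad-T = edges a d (inj₂ at₃)
          along  = λ {y} (t : Transition (G n) K a y) x →
            T-invariant 3≤n K proper (satisfies⇒regular 3≤n K proper cond) x (transition⇒T 3≤n K t)
          along' = λ {y} (t : Transition (G n) K' a y) x →
            T-invariant 3≤n K' proper' (satisfies⇒regular 3≤n K' proper' cond') x (transition⇒T 3≤n K' t)
          agree-at = λ {y} (y∈ : VertexOf (G n) C y) →
            subst (λ z → K z ≡ K' z) (sym (⊕-self a y)) (agree y y∈)
      in agree-from-square 3≤n proper proper' (b≢d ∘ ⊕-cancelˡ a)
           (along (proj₁ ab-T)) (along (proj₁ ad-T)) (along' (proj₂ ab-T)) (along' (proj₂ ad-T))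
           a (agree a at₀) (agree-at at₁) (agree-at at₃)
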